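{- Let $G$ be a connected graph of order $n$ with girth $g$ and minimum degree $\delta \geq 2$. Let $u$ be a vertex of $G$ and let $N$ be the number of vertices of $G$ at distance less than or equal to $\left\lfloor \frac{g-1}{2} \right\rfloor - 1$ from $u$. Then $p_u(G) \leq n - N$.
   Context: All graphs are finite, undirected and simple. A $u,v$-geodesic is a shortest $u,v$-path. The girth is the length of a shortest cycle. The vertex $u$ itself is at distance $0$ from $u$ and is counted in $N$. For a vertex $u$ of $G$, a set $S \subseteq V(G)$ is a $u$-position set if for every $y \in S$ no vertex of $S \setminus \{y\}$ lies on any $u,y$-geodesic in $G$. The $u$-position number $p_u(G)$ is the maximum cardinality of a $u$-position set of $G$. -}

module Defs where

open import Data.Fin.Base using (Fin)
open import Data.Fin.Subset using (Subset; _∈_; ∣_∣)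
open import Data.List.Base using (List; []; _∷_)
import Data.List.Membership.Propositional as List
open import Data.List.Relation.Unary.Unique.Propositional using (Unique)
open import Data.Nat.Base using (ℕ; suc; _≤_)
open import Data.Product.Base using (∃; ∃-syntax; _×_; proj₁)
open import Data.Vec.Base using (tabulate)
open import Function.Bundles using (_⇔_)
open import Level using (0ℓ)
open import Relation.Binary.Core using (Rel)
open import Relation.Binary.Definitions using (Decidable; Irreflexive; Symmetric)
open import Relation.Binary.PropositionalEquality.Core using (_≡_; _≢_)
open import Relation.Nullary.Decidable.Core using (does)
open import Relation.Nullary.Negation.Core using (¬_)

IsMinimumOf : (ℕ → Set) → ℕ → Set
IsMinimumOf P m = P m × (∀ k → P k → m ≤ k)

IsMaximumOf : (ℕ → Set) → ℕ → Set
IsMaximumOf P m = P m × (∀ k → P k → k ≤ m)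

HasCardinality : ∀ {n} → (Fin n → Set) → ℕ → Set
HasCardinality {n} P k =
  ∃[ S ] ((∀ (v : Fin n) → v ∈ S ⇔ P v) × ∣ S ∣ ≡ k)

record Graph (n : ℕ) : Set₁ where
  field
    _~_      : Rel (Fin n) 0ℓ
    _~?_     : Decidable _~_
    ~-sym    : Symmetric _~_
    ~-irrefl : Irreflexive _≡_ _~_

module _ {n : ℕ} (G : Graph n) where
  open Graph G

  degree : Fin n → ℕ
  degree v = ∣ tabulate (λ w → does (v ~? w)) ∣

  IsMinDegree : ℕ → Set
  IsMinDegree = IsMinimumOf (λ k → ∃[ v ] degree v ≡ k)

  data Walk : Fin n → Fin n → Set where
    nil  : ∀ {u} → Walk u u
    cons : ∀ {u v w} → u ~ v → Walk v w → Walk u w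

  length : ∀ {u v} → Walk u v → ℕ
  length nil        = 0
  length (cons _ p) = suc (length p)

  vertices : ∀ {u v} → Walk u v → List (Fin n)
  vertices {u} nil        = u ∷ []
  vertices {u} (cons _ p) = u ∷ vertices p

  IsPath : ∀ {u v} → Walk u v → Set
  IsPath p = Unique (vertices p)

  Path : Fin n → Fin n → Set
  Path u v = ∃ λ (p : Walk u v) → IsPath p

  Connected : Set
  Connected = ∀ u v → Path u v

  IsDistance : Fin n → Fin n → ℕ → Set
  IsDistance u v =
    IsMinimumOf (λ k → ∃ λ (p : Path u v) → length (proj₁ p) ≡ k)

  IsGeodesic : ∀ {u v} → Walk u v → Set
  IsGeodesic {u} {v} p =
    IsPath p × (∀ (q : Walk u v) → IsPath q → length p ≤ length q)

  -- A cycle is a path on at least three vertices together with an edge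
  -- joining its two ends.
  record Cycle : Set where
    field
      {first last} : Fin n
      path         : Walk first last
      isPath       : IsPath path
      long         : 2 ≤ length path
      closing      : last ~ first

  cycleLength : Cycle → ℕ
  cycleLength c = suc (length (Cycle.path c))

  IsGirth : ℕ → Set
  IsGirth = IsMinimumOf (λ k → ∃[ c ] cycleLength c ≡ k)

  WithinDistance : Fin n → ℕ → Fin n → Set
  WithinDistance u r v = ∃[ d ] (IsDistance u v d × d ≤ r)

  IsPositionSet : Fin n → Subset n → Set
  IsPositionSet u S =
    ∀ y → y ∈ S → ∀ x → x ∈ S → x ≢ y →
    (p : Walk u y) → IsGeodesic p → ¬ (x List.∈ vertices p)

  IsPositionNumber : Fin n → ℕ → Set
  IsPositionNumber u =
    IsMaximumOf (λ k → ∃[ S ] (IsPositionSet u S × ∣ S ∣ ≡ k))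

{-# OPTIONS --safe #-}

-- Write r + 1 = ⌊(g-1)/2⌋, so that 2(r + 1) < g.  A non-backtracking walk shorter
-- than the girth is a path, hence two non-backtracking walks with the same ends and
-- total length below g coincide: otherwise, after cancelling their common start, one
-- reversed and followed by the other would be a closed path.  So non-backtracking
-- walks of length at most r + 1 ending at u are (reversed) geodesics, and a
-- u-position set S meets each of them at most once.  As δ ≥ 2, every y ∈ S within
-- distance r of u can be pushed away from u to some z at distance exactly r + 1.
-- Sending these y to z and fixing the other elements of S maps S injectively into
-- the complement of the ball of radius r.

module Submission where

open import Defs
open import Data.Bool.Base using (true)
open import Data.Empty using (⊥-elim)
open import Data.Fin.Base using (Fin; zero; suc)
import Data.Fin.Properties as Fin
open import Data.Fin.Subset using (Subset; inside; outside; _∈_; _∉_; ∣_∣; ∁; _-_; ⁅_⁆)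
open import Data.Fin.Subset.Properties
  using (_∈?_; x∈⁅x⁆; ∣⁅x⁆∣≡1; p⊆q⇒∣p∣≤∣q∣; x∉p⇒x∈∁p; x∈p∧x≢y⇒x∈p-y; x∈p⇒∣p-x∣<∣p∣; ∣∁p∣≡n∸∣p∣)
import Data.List.Base as List
import Data.List.Membership.DecPropositional as DecMembership
import Data.List.Membership.Propositional as List
import Data.List.Relation.Binary.Subset.Propositional as List
import Data.List.Relation.Unary.All as All
import Data.List.Relation.Unary.All.Properties as All
open import Data.List.Relation.Unary.AllPairs using ([]; _∷_)
open import Data.List.Relation.Unary.Any using (here; there)
open import Data.Nat.Base
  using (ℕ; zero; suc; _+_; _∸_; _≤_; _<_; z≤n; s≤s; s≤s⁻¹)
open import Data.Nat.DivMod using (_/_; m/n*n≤m; m≥n⇒m/n>0)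
open import Data.Nat.Properties
open import Data.Product.Base using (_×_; _,_; ∃; ∃-syntax; proj₂)
open import Data.Sum.Base using (_⊎_; inj₁; inj₂)
open import Data.Unit.Base using (⊤; tt)
open import Data.Vec.Base using ([]; _∷_; here; there; tabulate)
open import Data.Vec.Properties using ([]=⇒lookup; lookup∘tabulate)
open import Function.Base using (_∘_)
open import Function.Bundles using (Equivalence)
open import Relation.Binary.PropositionalEquality
  using (_≡_; _≢_; refl; sym; trans; cong; subst; ≢-sym)
open import Relation.Nullary.Decidable using (Dec; yes; no; does; ¬?; _×-dec_; decidable-stable)
open import Relation.Nullary.Negation using (¬_; contradiction)

-- Counting in finite sets and the bound on the radius

injection⇒∣∣≤ : ∀ {m n} (S : Subset m) (T : Subset n) (R : Fin m → Fin n → Set) →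
  (∀ x → x ∈ S → ∃[ y ] (y ∈ T × R x y)) →
  (∀ {x x′ y} → R x y → R x′ y → x ≡ x′) →
  ∣ S ∣ ≤ ∣ T ∣
injection⇒∣∣≤ [] T R total injective = z≤n
injection⇒∣∣≤ (outside ∷ S) T R total injective =
  injection⇒∣∣≤ S T (R ∘ suc) (λ x x∈S → total (suc x) (there x∈S))
    (λ r r′ → Fin.suc-injective (injective r r′))
injection⇒∣∣≤ (inside ∷ S) T R total injective with total zero here
... | y₀ , y₀∈T , r₀ = ≤-<-trans
  -- The image `y₀` of the first element is removed from `T`; by injectivity no later element is
  -- related to it, so the remaining images survive in `T - y₀`.
  (injection⇒∣∣≤ S (T - y₀) (R ∘ suc) total′
    (λ r r′ → Fin.suc-injective (injective r r′)))
  (x∈p⇒∣p-x∣<∣p∣ y₀∈T)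
  where
  total′ : ∀ x → x ∈ S → ∃[ y ] (y ∈ T - y₀ × R (suc x) y)
  total′ x x∈S with total (suc x) (there x∈S)
  ... | y , y∈T , r = y , x∈p∧x≢y⇒x∈p-y y∈T y≢y₀ , r
    where
    y≢y₀ : y ≢ y₀
    y≢y₀ refl with injective r₀ r
    ... | ()

2≤∣T∣⇒∃≢ : ∀ {n} (T : Subset n) → 2 ≤ ∣ T ∣ → ∀ x → ∃[ y ] (y ∈ T × y ≢ x)
2≤∣T∣⇒∃≢ T 2≤∣T∣ x with Fin.any? (λ y → (y ∈? T) ×-dec ¬? (y Fin.≟ x))
... | yes found = found
... | no none = contradiction 2≤∣T∣ (<⇒≱ (s≤s (≤-trans (p⊆q⇒∣p∣≤∣q∣ T⊆⁅x⁆) (≤-reflexive (∣⁅x⁆∣≡1 x)))))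
  where
  T⊆⁅x⁆ : ∀ {y} → y ∈ T → y ∈ ⁅ x ⁆
  T⊆⁅x⁆ {y} y∈T = subst (_∈ ⁅ x ⁆)
    (sym (decidable-stable (y Fin.≟ x) λ y≢x → none (y , y∈T , y≢x))) (x∈⁅x⁆ x)

∈-tabulate-does : ∀ {n} {P : Fin n → Set} (P? : ∀ x → Dec (P x)) {x} →
  x ∈ tabulate (λ y → does (P? y)) → P x
∈-tabulate-does {P = P} P? {x} x∈ =
  true⇒ (P? x) (trans (sym (lookup∘tabulate (does ∘ P?) x)) ([]=⇒lookup x∈))
  where
  true⇒ : (d : Dec (P x)) → does d ≡ true → P x
  true⇒ (yes px) _ = px

-- From `3 ≤ g` the half `(g ∸ 1) / 2` is positive, so `suc` undoes the truncated `∸ 1`; twice the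
-- floor of a half is then at most `g ∸ 1`.
2[r+1]<g : ∀ g → 3 ≤ g → suc ((g ∸ 1) / 2 ∸ 1) + suc ((g ∸ 1) / 2 ∸ 1) < g
2[r+1]<g (suc k) 3≤g = s≤s (subst (λ h → h + h ≤ k) (sym 1+[h∸1]≡h) h+h≤k)
  where
  1+[h∸1]≡h : suc (k / 2 ∸ 1) ≡ k / 2
  1+[h∸1]≡h = m+[n∸m]≡n (m≥n⇒m/n>0 (s≤s⁻¹ 3≤g))
  h+h≤k : k / 2 + k / 2 ≤ k
  h+h≤k = subst (_≤ k)
    (trans (*-comm (k / 2) 2) (cong (k / 2 +_) (+-identityʳ (k / 2)))) (m/n*n≤m k 2)

-- Non-backtracking walks

module _ {n : ℕ} (G : Graph n) where
  open Graph G
  open DecMembership (Fin._≟_ {n}) using () renaming (_∈?_ to _∈ₗ?_)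

  -- Vacuous on `nil`: a walk without edges has no second vertex, so any edge may be put in front of
  -- it.
  _≢second_ : ∀ {v w} → Fin n → Walk G v w → Set
  x ≢second nil              = ⊤
  x ≢second (cons {v = y} _ _) = x ≢ y

  NonBacktracking : ∀ {v w} → Walk G v w → Set
  NonBacktracking nil              = ⊤
  NonBacktracking (cons {u = u} _ p) = u ≢second p × NonBacktracking p

  first∈vertices : ∀ {v w} (p : Walk G v w) → v List.∈ vertices G p
  first∈vertices nil        = here refl
  first∈vertices (cons _ _) = here refl

  last∈vertices : ∀ {v w} (p : Walk G v w) → w List.∈ vertices G p
  last∈vertices nil        = here refl
  last∈vertices (cons _ p) = there (last∈vertices p)

  length-vertices : ∀ {v w} (p : Walk G v w) → List.length (vertices G p) ≡ suc (length G p)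
  length-vertices nil        = refl
  length-vertices (cons _ p) = cong suc (length-vertices p)

  vertices≡⇒length≡ : ∀ {v w v′ w′} (p : Walk G v w) (q : Walk G v′ w′) →
    vertices G p ≡ vertices G q → length G p ≡ length G q
  vertices≡⇒length≡ p q eq = suc-injective
    (trans (sym (length-vertices p)) (trans (cong List.length eq) (length-vertices q)))

  path⇒nonBacktracking : ∀ {v w} (p : Walk G v w) → IsPath G p → NonBacktracking p
  path⇒nonBacktracking nil _ = tt
  path⇒nonBacktracking (cons _ nil) _ = tt , tt
  path⇒nonBacktracking (cons _ p@(cons _ p′)) (u∉ ∷ path) =
    All.lookup u∉ (there (first∈vertices p′)) , path⇒nonBacktracking p path

  ¬closedPath : ∀ {v} (p : Walk G v v) → 0 < length G p → ¬ IsPath G p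
  ¬closedPath (cons _ p) _ (v∉ ∷ _) = All.lookup v∉ (last∈vertices p) refl

  -- Initial segments of walks

  prefix : ∀ {v w x} (p : Walk G v w) → x List.∈ vertices G p → Walk G v x
  prefix nil        (here refl) = nil
  prefix (cons _ _) (here refl) = nil
  prefix (cons e p) (there i)   = cons e (prefix p i)

  length-prefix : ∀ {v w x} (p : Walk G v w) (i : x List.∈ vertices G p) →
    length G (prefix p i) ≤ length G p
  length-prefix nil        (here refl) = z≤n
  length-prefix (cons _ _) (here refl) = z≤n
  length-prefix (cons _ p) (there i)   = s≤s (length-prefix p i)

  vertices-prefix⊆ : ∀ {v w x} (p : Walk G v w) (i : x List.∈ vertices G p) →
    vertices G (prefix p i) List.⊆ vertices G p
  vertices-prefix⊆ nil        (here refl) j         = j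
  vertices-prefix⊆ (cons _ _) (here refl) (here eq) = here eq
  vertices-prefix⊆ (cons _ _) (there _)   (here eq) = here eq
  vertices-prefix⊆ (cons _ p) (there i)   (there j) = there (vertices-prefix⊆ p i j)

  prefix-isPath : ∀ {v w x} (p : Walk G v w) (i : x List.∈ vertices G p) →
    IsPath G p → IsPath G (prefix p i)
  prefix-isPath nil        (here refl) path        = path
  prefix-isPath (cons _ _) (here refl) _           = All.[] ∷ []
  prefix-isPath (cons _ p) (there i)   (u∉ ∷ path) =
    All.anti-mono (vertices-prefix⊆ p i) u∉ ∷ prefix-isPath p i path

  -- Irreflexivity keeps `u` from being the first vertex of `p`, and non-backtracking from being the
  -- second. This yields the field `long` of a cycle closed by `e`.
  2≤length-prefix : ∀ {u v w} (e : u ~ v) (p : Walk G v w) (i : u List.∈ vertices G p) →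
    u ≢second p → 2 ≤ length G (prefix p i)
  2≤length-prefix e nil                   (here refl)         _   = ⊥-elim (~-irrefl refl e)
  2≤length-prefix e (cons _ _)            (here refl)         _   = ⊥-elim (~-irrefl refl e)
  2≤length-prefix _ (cons _ nil)          (there (here refl)) u≢u = ⊥-elim (u≢u refl)
  2≤length-prefix _ (cons _ (cons _ _))   (there (here refl)) u≢u = ⊥-elim (u≢u refl)
  2≤length-prefix _ (cons _ (cons _ _))   (there (there _))   _   = s≤s (s≤s z≤n)

  -- Reversal, and joining two walks at a common start

  reverseAppend : ∀ {a b c} → Walk G a b → Walk G a c → Walk G b c
  reverseAppend nil        q = q
  reverseAppend (cons e p) q = reverseAppend p (cons (~-sym e) q)

  length-reverseAppend : ∀ {a b c} (p : Walk G a b) (q : Walk G a c) →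
    length G (reverseAppend p q) ≡ length G p + length G q
  length-reverseAppend nil        q = refl
  length-reverseAppend (cons e p) q =
    trans (length-reverseAppend p (cons (~-sym e) q)) (+-suc (length G p) (length G q))

  ∈-reverseAppendʳ : ∀ {a b c x} (p : Walk G a b) (q : Walk G a c) →
    x List.∈ vertices G q → x List.∈ vertices G (reverseAppend p q)
  ∈-reverseAppendʳ nil        q i = i
  ∈-reverseAppendʳ (cons e p) q i = ∈-reverseAppendʳ p (cons (~-sym e) q) (there i)

  ∈-reverseAppendˡ : ∀ {a b c x} (p : Walk G a b) (q : Walk G a c) →
    x List.∈ vertices G p → x List.∈ vertices G (reverseAppend p q)
  ∈-reverseAppendˡ nil        q (here refl) = first∈vertices q
  ∈-reverseAppendˡ (cons e p) q (here refl) =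
    ∈-reverseAppendʳ p (cons (~-sym e) q) (there (first∈vertices q))
  ∈-reverseAppendˡ (cons e p) q (there i)   = ∈-reverseAppendˡ p (cons (~-sym e) q) i

  -- Non-backtracking at the junction of `reverseAppend`; vacuous if either walk is `nil`.
  FirstStepsDiffer : ∀ {a b c} → Walk G a b → Walk G a c → Set
  FirstStepsDiffer nil                _ = ⊤
  FirstStepsDiffer (cons {v = v} _ _) q = v ≢second q

  reverseAppend-nonBacktracking : ∀ {a b c} (p : Walk G a b) (q : Walk G a c) →
    NonBacktracking p → NonBacktracking q → FirstStepsDiffer p q →
    NonBacktracking (reverseAppend p q)
  reverseAppend-nonBacktracking nil        q _         nbq _ = nbq
  reverseAppend-nonBacktracking (cons e p) q (u≢ , nbp) nbq v≢ =
    -- Moving one edge across exchanges the roles: the junction condition `v≢` makes the longer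
    -- second walk non-backtracking, and `u≢` is the condition at the new junction.
    reverseAppend-nonBacktracking p (cons (~-sym e) q) nbp (v≢ , nbq) (differ p u≢)
    where
    differ : ∀ {b} (p : Walk G _ b) → _ ≢second p → FirstStepsDiffer p (cons (~-sym e) q)
    differ nil        _   = tt
    differ (cons _ _) u≢w = ≢-sym u≢w

  reverse : ∀ {a b} → Walk G a b → Walk G b a
  reverse p = reverseAppend p nil

  length-reverse : ∀ {a b} (p : Walk G a b) → length G (reverse p) ≡ length G p
  length-reverse p = trans (length-reverseAppend p nil) (+-identityʳ _)

  reverse-nonBacktracking : ∀ {a b} (p : Walk G a b) →
    NonBacktracking p → NonBacktracking (reverse p)
  reverse-nonBacktracking p nb = reverseAppend-nonBacktracking p nil nb tt (differ p)
    where
    differ : ∀ {a b} (p : Walk G a b) → FirstStepsDiffer p nil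
    differ nil        = tt
    differ (cons _ _) = tt

  -- Extending walks when all degrees are at least two

  module _ (2≤degree : ∀ v → 2 ≤ degree G v) where

    neighbour≢ : ∀ v x → ∃[ w ] (v ~ w × w ≢ x)
    neighbour≢ v x with 2≤∣T∣⇒∃≢ _ (2≤degree v) x
    ... | w , w∈ , w≢x = w , ∈-tabulate-does (v ~?_) w∈ , w≢x

    step : ∀ {y u} (p : Walk G y u) → ∃[ z ] (z ~ y × z ≢second p)
    -- Nothing has to be avoided here; the second `y` is a dummy value.
    step {y} nil with neighbour≢ y y
    ... | z , y~z , _ = z , ~-sym y~z , tt
    step {y} (cons {v = x} _ _) with neighbour≢ y x
    ... | z , y~z , z≢x = z , ~-sym y~z , z≢x

    -- Walks end at `u` and grow at their start, where some neighbour always differs from the second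
    -- vertex; the given walk stays a final segment, so `y` remains on the result.
    extend : ∀ k {y u} (p : Walk G y u) → NonBacktracking p →
      ∃[ z ] ∃ λ (q : Walk G z u) →
        NonBacktracking q × length G q ≡ k + length G p × y List.∈ vertices G q
    extend zero    p nb = _ , p , nb , refl , first∈vertices p
    extend (suc k) p nb with extend k p nb
    ... | _ , q , nbq , len , y∈q with step q
    ... | z , e , z≢ = z , cons e q , (z≢ , nbq) , cong suc len , there y∈q

  -- Short walks below the girth

  module _ {g : ℕ} (g≤cycleLength : ∀ c → g ≤ cycleLength G c) where

    -- By induction the tail is a path. Were `u` on it, the tail up to `u` would be closed by `e`
    -- into a cycle no longer than the walk, hence shorter than `g`.
    short⇒path : ∀ {v w} (p : Walk G v w) → NonBacktracking p → length G p < g → IsPath G p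
    short⇒path nil _ _ = All.[] ∷ []
    short⇒path (cons {u = u} e p) (u≢ , nb) short with short⇒path p nb (<-trans (n<1+n _) short)
    ... | path with u ∈ₗ? vertices G p
    ... | no u∉p = All.tabulate (λ { x∈p refl → u∉p x∈p }) ∷ path
    ... | yes u∈p = contradiction
      (≤-trans (g≤cycleLength cycle) (s≤s (length-prefix p u∈p))) (<⇒≱ short)
      where
      cycle : Cycle G
      cycle = record
        { path    = prefix p u∈p
        ; isPath  = prefix-isPath p u∈p path
        ; long    = 2≤length-prefix e p u∈p u≢
        ; closing = e
        }

    -- Vertex lists are compared because the adjacency proofs in two walks may differ. Once the
    -- first steps differ, `reverseAppend p q` is a non-backtracking walk from `b` to `b`, of
    -- positive length below `g`.
    short-unique : ∀ {a b} (p q : Walk G a b) → NonBacktracking p → NonBacktracking q →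
      length G p + length G q < g → vertices G p ≡ vertices G q
    short-unique nil nil _ _ _ = refl
    short-unique nil q@(cons _ _) _ nbq short =
      contradiction (short⇒path q nbq short) (¬closedPath q (s≤s z≤n))
    short-unique p@(cons _ _) nil nbp _ short =
      contradiction (short⇒path p nbp (subst (_< g) (+-identityʳ _) short)) (¬closedPath p (s≤s z≤n))
    short-unique p@(cons {v = v} e p′) q@(cons {v = w} f q′) nbp nbq short with v Fin.≟ w
    ... | yes refl = cong (_ List.∷_) (short-unique p′ q′ (proj₂ nbp) (proj₂ nbq)
      (≤-<-trans (+-mono-≤ (n≤1+n _) (n≤1+n _)) short))
    ... | no v≢w = contradiction
      (short⇒path (reverseAppend p q) (reverseAppend-nonBacktracking p q nbp nbq v≢w)
        (subst (_< g) (sym (length-reverseAppend p q)) short))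
      (¬closedPath (reverseAppend p q) (subst (0 <_) (sym (length-reverseAppend p q)) (s≤s z≤n)))

    -- Together with a strictly shorter path the total length would still be below `g`, so
    -- uniqueness would force equal lengths.
    short⇒geodesic : ∀ {a b} (p : Walk G a b) → NonBacktracking p →
      length G p + length G p < g → IsGeodesic G p
    short⇒geodesic p nb short = short⇒path p nb (m+n≤o⇒m≤o _ short) , shortest
      where
      shortest : ∀ q → IsPath G q → length G p ≤ length G q
      shortest q path = ≮⇒≥ λ q<p → <⇒≢ q<p (sym (vertices≡⇒length≡ p q
        (short-unique p q nb (path⇒nonBacktracking q path)
          (<-trans (+-monoʳ-< (length G p) q<p) short))))

    -- If the start of `q` is in `S`, the reverse of `q` is a geodesic from `u` to it and meets `S`
    -- nowhere else. If both vertices lie beyond the start, the same argument applies to the tail,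
    -- which still ends at `u`.
    positionSet-unique : ∀ {u S} → IsPositionSet G u S →
      ∀ {z} (q : Walk G z u) → NonBacktracking q → length G q + length G q < g →
      ∀ {x y} → x ∈ S → y ∈ S → x List.∈ vertices G q → y List.∈ vertices G q → x ≡ y
    positionSet-unique {u} {S} pos = unique
      where
      first-unique : ∀ {z} (q : Walk G z u) → NonBacktracking q → length G q + length G q < g →
        z ∈ S → ∀ {x} → x ∈ S → x List.∈ vertices G q → x ≡ z
      first-unique {z} q nb short z∈S {x} x∈S x∈q = decidable-stable (x Fin.≟ z) λ x≢z →
        pos z z∈S x x∈S x≢z (reverse q)
          (short⇒geodesic (reverse q) (reverse-nonBacktracking q nb)
            (subst (λ l → l + l < g) (sym (length-reverse q)) short))
          (∈-reverseAppendˡ q nil x∈q)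

      unique : ∀ {z} (q : Walk G z u) → NonBacktracking q → length G q + length G q < g →
        ∀ {x y} → x ∈ S → y ∈ S → x List.∈ vertices G q → y List.∈ vertices G q → x ≡ y
      unique nil _ _ _ _ (here refl) (here refl) = refl
      unique q@(cons _ _) nb short x∈S y∈S x∈q (here refl) = first-unique q nb short y∈S x∈S x∈q
      unique q@(cons _ _) nb short x∈S y∈S (here refl) y∈q =
        sym (first-unique q nb short x∈S y∈S y∈q)
      unique (cons _ q) (_ , nb) short x∈S y∈S (there x∈q) (there y∈q) =
        unique q nb (≤-<-trans (+-mono-≤ (n≤1+n _) (n≤1+n _)) short) x∈S y∈S x∈q y∈q

-- Mapping a position set injectively into the complement of the ball

theorem3p7 : ∀ {n : ℕ} (G : Graph n) (g δ : ℕ) →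
    Connected G →
    IsGirth G g →
    IsMinDegree G δ →
    2 ≤ δ →
    (u : Fin n) (N : ℕ) →
    HasCardinality (WithinDistance G u ((g ∸ 1) / 2 ∸ 1)) N →
    (p : ℕ) →
    IsPositionNumber G u p →
    p ≤ n ∸ N
theorem3p7 {n} G g δ _ ((c , |c|≡g) , minimal) (_ , δ≤) 2≤δ u N (B , B⇔ , refl) _
  ((S , pos , refl) , _) =
  subst (∣ S ∣ ≤_) (∣∁p∣≡n∸∣p∣ B) (injection⇒∣∣≤ S (∁ B) R total injective)
  where
  r : ℕ
  r = (g ∸ 1) / 2 ∸ 1

  r+1+r+1<g : suc r + suc r < g
  -- The cycle attaining the girth has length at least three.
  r+1+r+1<g = 2[r+1]<g g (subst (3 ≤_) |c|≡g (s≤s (Cycle.long c)))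

  g≤cycleLength : ∀ c → g ≤ cycleLength G c
  g≤cycleLength c = minimal _ (c , refl)

  2≤degree : ∀ v → 2 ≤ degree G v
  2≤degree v = ≤-trans 2≤δ (δ≤ _ (v , refl))

  Escapes : Fin n → Fin n → Set
  Escapes y z = ∃ λ (q : Walk G z u) →
    NonBacktracking G q × length G q ≡ suc r × y List.∈ vertices G q

  -- Membership in `S` is built in, since injectivity rests on the position property of both
  -- elements.
  R : Fin n → Fin n → Set
  R y z = y ∈ S × (y ≡ z ⊎ Escapes y z)

  short : ∀ {l} → l ≡ suc r → l + l < g
  short refl = r+1+r+1<g

  injective : ∀ {x y z} → R x z → R y z → x ≡ y
  injective (_ , inj₁ refl) (_ , inj₁ refl) = refl
  injective (x∈S , inj₁ refl) (y∈S , inj₂ (q , nb , len , y∈q)) =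
    positionSet-unique G g≤cycleLength pos q nb (short len) x∈S y∈S (first∈vertices G q) y∈q
  injective (x∈S , inj₂ (q , nb , len , x∈q)) (y∈S , inj₁ refl) =
    positionSet-unique G g≤cycleLength pos q nb (short len) x∈S y∈S x∈q (first∈vertices G q)
  injective (x∈S , inj₂ (q , nb , len , x∈q)) (y∈S , inj₂ (q′ , nb′ , len′ , y∈q′)) =
    -- Both walks run from `z` to `u` with length `suc r`, so they have the same vertices and `y`
    -- also lies on `q`.
    positionSet-unique G g≤cycleLength pos q nb (short len) x∈S y∈S x∈q
      (subst (_ List.∈_) (short-unique G g≤cycleLength q′ q nb′ nb
        (subst (λ l → l + length G q < g) (trans len (sym len′)) (short len))) y∈q′)

  -- A path of length at most `r` between `u` and `z` would, by uniqueness, have the vertices of a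
  -- walk of length `suc r`.
  escape∉B : ∀ {y z} → Escapes y z → z ∉ B
  escape∉B {z = z} (q , nb , len , _) z∈B with Equivalence.to (B⇔ z) z∈B
  ... | _ , (((p , path) , refl) , _) , |p|≤r =
    <⇒≢ |p′|<|q| (vertices≡⇒length≡ G p′ q (short-unique G g≤cycleLength p′ q
      (reverse-nonBacktracking G p (path⇒nonBacktracking G p path)) nb
      (<-trans (+-monoˡ-< (length G q) |p′|<|q|) (short len))))
    where
    p′ : Walk G z u
    p′ = reverse G p
    |p′|<|q| : length G p′ < length G q
    |p′|<|q| = subst (length G p′ <_) (sym len) (s≤s (subst (_≤ r) (sym (length-reverse G p)) |p|≤r))

  escape : ∀ {y} → y ∈ B → ∃[ z ] Escapes y z
  escape {y} y∈B with Equivalence.to (B⇔ y) y∈B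
  ... | _ , (((p , path) , refl) , _) , |p|≤r
    -- The path to `y` is reversed so that new edges are added at `y`. As its length is at most `r`,
    -- the truncated difference is exact and the total is `suc r`.
    with extend G 2≤degree (suc r ∸ length G (reverse G p)) (reverse G p)
           (reverse-nonBacktracking G p (path⇒nonBacktracking G p path))
  ... | z , q , nb , len , y∈q = z , q , nb , trans len (m∸n+n≡m |p′|≤r+1) , y∈q
    where
    |p′|≤r+1 : length G (reverse G p) ≤ suc r
    |p′|≤r+1 = subst (_≤ suc r) (sym (length-reverse G p)) (m≤n⇒m≤1+n |p|≤r)

  total : ∀ y → y ∈ S → ∃[ z ] (z ∈ ∁ B × R y z)
  total y y∈S with y ∈? B
  ... | no y∉B = y , x∉p⇒x∈∁p y∉B , y∈S , inj₁ refl
  ... | yes y∈B with escape y∈B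
  ... | z , esc = z , x∉p⇒x∈∁p (escape∉B esc) , y∈S , inj₂ esc
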